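{- Let $R$ be a discrete valuation ring whose residue field has characteristic zero, with uniformizing parameter $t$. Let $(M,N)$ and $(M',N')$ be pairs of full-rank $r\times r$ matrices over $R$ which are pair equivalent, and let $\mu=inv(M)$ $(=inv(M'))$. Let $N^*$ and $N'^*$ be $\mu$-generic matrices such that $(D_\mu,N^*)$ is pair equivalent to $(M,N)$ and $(D_\mu,N'^*)$ is pair equivalent to $(M',N')$. Then the Littlewood–Richardson filling determined by $N^*$ equals the one determined by $N'^*$; that is, the arrays $\{k_{ij}\}$ defined from $N^*$ and from $N'^*$ by the rule in the context coincide.
   Context: For $0\ne a\in R$ write $a=ut^k$ with $u$ a unit and set $\|a\|=k$; for a square matrix $B$, $\|B\|=\|\det B\|$ (with $\|0\|=+\infty$). $inv(M)$ denotes the partition $(\mu_1\ge\dots\ge\mu_r\ge 0)$ of orders of the invariant factors of a full-rank $M$ (so $PMQ^{ -1}=\mathrm{diag}(t^{\mu_1},\dots,t^{\mu_r})$ for some $P,Q\in GL_r(R)$), and $D_\mu=\mathrm{diag}(t^{\mu_1},\dots,t^{\mu_r})$. Pairs $(M,N),(M',N')$ are pair equivalent if $(M',N')=(PMQ^{ -1},QNT^{ -1})$ for some $P,Q,T\in GL_r(R)$. $Q\in GL_r(R)$ is $\mu$-admissible if $D_\mu QD_\mu^{ -1}\in GL_r(R)$. For index sets $I=(i_1<\dots<i_k)$, $H=(h_1<\dots<h_k)$ in $\{1,\dots,r\}$, $I\subseteq H$ means $i_s\le h_s$ for all $s$; $W_{IJ}$ is the minor of $W$ with rows $I$, columns $J$;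 $|\mu_I|=\sum_s\mu_{i_s}$. An $r\times r$ matrix $N^*$ is $\mu$-generic if there exist a full-rank $N\in M_r(R)$ and invertible matrices $Q_U,Q_L,T_L,T_U$ over $R$ with $Q_U$ upper triangular $\mu$-admissible, $Q_L$ lower triangular $\mu$-admissible, $T_U$ upper triangular, $T_L$ a permutation matrix times (on the right) a lower triangular matrix, such that with $Q=Q_UQ_L$, $T^{ -1}=T_LT_U$: $N^*=QNT^{ -1}$; $Q=\widehat{Q_L}\widehat{Q_U}$ with $\widehat{Q_L},\widehat{Q_U}$ lower/upper triangular $\mu$-admissible over $R$; $Q_LNT_L$ is upper triangular; and for all index sets $I,J$ of equal length, $\|(QNT^{ -1})_{IJ}\|=\min_{I\subseteq S}\|(Q_LNT^{ -1})_{SJ}\|=\min_{H\subseteq I}\{\|(\widehat{Q_U}NT^{ -1})_{HJ}\|+|\mu_H|-|\mu_I|\}=\min_{H\subseteq J}\|(QNT_L)_{IH}\|$. Filling determined by a $\mu$-generic $N^*$: for integers $a\le b$, let $\Omega(a,b)$ be the order of the minor of $N^*$ with rows $\{1,\dots,r\}\setminus\{a,\dots,b\}$ (indices outside $\{1,\dots,r\}$ ignored) and the right-most columns (the last $m$ columns, $m$ the number of rows kept; empty minor has order $0$). The array $\{k_{ij}:1\le i\le j\le r\}$ is defined by $k_{1j}+\dots+k_{ij}=\Omega(j-i,j-1)-\Omega(j-i+1,j)$ for all $1\le i\le j\le r$. -}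

module Defs where

open import Level using (Level; _⊔_) renaming (suc to lsuc)
open import Algebra.Bundles using (CommutativeRing)
open import Data.Nat as ℕ using (ℕ; zero; suc; _∸_)
open import Data.Nat.Properties as ℕP using ()
open import Data.Fin as Fin using (Fin; zero; suc; toℕ; punchIn; opposite; inject≤)
open import Data.Fin.Permutation using (Permutation′; _⟨$⟩ʳ_)
open import Data.List as List using (List; filter; length; lookup; allFin)
open import Data.List.Properties using (length-filter; length-tabulate)
open import Data.Product using (Σ; ∃; ∃-syntax; _×_; _,_)
open import Data.Sum using (_⊎_)
open import Data.Maybe using (Maybe; just; nothing)
open import Data.Integer as ℤ using (ℤ)
open import Relation.Nullary using (¬_; yes; no)
open import Relation.Nullary.Decidable using (_⊎-dec_)
open import Relation.Binary.PropositionalEquality using (_≡_; subst)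

data ℕ∞ : Set where
  fin : ℕ → ℕ∞
  ∞   : ℕ∞

infixl 6 _+∞_
_+∞_ : ℕ∞ → ℕ∞ → ℕ∞
fin m +∞ fin n = fin (m ℕ.+ n)
fin _ +∞ ∞     = ∞
∞     +∞ _     = ∞

infix 4 _≤∞_
data _≤∞_ : ℕ∞ → ℕ∞ → Set where
  fin≤fin : ∀ {m n} → m ℕ.≤ n → fin m ≤∞ fin n
  ≤∞-top  : ∀ x → x ≤∞ ∞

IsMinOf : ∀ {a p} {A : Set a} → ℕ∞ → (A → Set p) → (A → ℕ∞) → Set (a ⊔ p)
IsMinOf x P f = (∃[ S ] (P S × f S ≡ x)) × (∀ S → P S → x ≤∞ f S)

powR : ∀ {c ℓ} (R : CommutativeRing c ℓ) → CommutativeRing.Carrier R → ℕ → CommutativeRing.Carrier R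
powR R x zero    = CommutativeRing.1# R
powR R x (suc n) = CommutativeRing._*_ R x (powR R x n)

record DVR c ℓ : Set (lsuc (c ⊔ ℓ)) where
  field
    dvrRing : CommutativeRing c ℓ
  open CommutativeRing dvrRing public
  _^_ : Carrier → ℕ → Carrier
  _^_ = powR dvrRing
  IsUnit : Carrier → Set (c ⊔ ℓ)
  IsUnit u = ∃[ v ] (u * v ≈ 1#)
  field
    t          : Carrier
    nontrivial : ¬ (1# ≈ 0#)
    domain     : ∀ a b → a * b ≈ 0# → a ≈ 0# ⊎ b ≈ 0#
    t-nonzero  : ¬ (t ≈ 0#)
    t-nonunit  : ¬ IsUnit t
    ord        : Carrier → ℕ∞
    ord-∞      : ∀ a → ord a ≡ ∞ → a ≈ 0#
    ord-fin    : ∀ a k → ord a ≡ fin k → ∃[ u ] (IsUnit u × a ≈ u * (t ^ k))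

module _ {c ℓ} (D : DVR c ℓ) where
  open DVR D using (Carrier; _≈_; _+_; _*_; 0#; 1#; t)
  natR : ℕ → Carrier
  natR zero    = 0#
  natR (suc n) = 1# + natR n

  ResidueChar0 : Set (c ⊔ ℓ)
  ResidueChar0 = ∀ n → ¬ (∃[ x ] (natR (suc n) ≈ t * x))

module Mats {c ℓ} (D : DVR c ℓ) where
  open DVR D using (Carrier; _≈_; _+_; _*_; -_; 0#; 1#; _^_; t; ord)

  Mat : ℕ → Set c
  Mat n = Fin n → Fin n → Carrier

  sumF : ∀ n → (Fin n → Carrier) → Carrier
  sumF zero    f = 0#
  sumF (suc n) f = f zero + sumF n (λ i → f (suc i))

  sumℕ : ∀ n → (Fin n → ℕ) → ℕ
  sumℕ zero    f = 0
  sumℕ (suc n) f = f zero ℕ.+ sumℕ n (λ i → f (suc i))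

  infixl 7 _⊗_
  _⊗_ : ∀ {n} → Mat n → Mat n → Mat n
  _⊗_ {n} A B i j = sumF n (λ k → A i k * B k j)

  infix 4 _≈M_
  _≈M_ : ∀ {n} → Mat n → Mat n → Set ℓ
  A ≈M B = ∀ i j → A i j ≈ B i j

  diag : ∀ {n} → (Fin n → Carrier) → Mat n
  diag d i j with i Fin.≟ j
  ... | yes _ = d i
  ... | no  _ = 0#

  Id : ∀ {n} → Mat n
  Id = diag (λ _ → 1#)

  Invertible : ∀ {n} → Mat n → Set (c ⊔ ℓ)
  Invertible {n} A = ∃[ B ] (A ⊗ B ≈M Id × B ⊗ A ≈M Id)

  record GL (n : ℕ) : Set (c ⊔ ℓ) where
    field
      mat    : Mat n
      inv    : Mat n
      mat-inv : mat ⊗ inv ≈M Id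
      inv-mat : inv ⊗ mat ≈M Id

  det : ∀ n → Mat n → Carrier
  det zero    A = 1#
  det (suc n) A = sumF (suc n) (λ j →
      ((- 1#) ^ toℕ j) * (A zero j * det n (λ a b → A (suc a) (punchIn j b))))

  ‖_‖ : Carrier → ℕ∞
  ‖ a ‖ = ord a

  FullRank : ∀ {n} → Mat n → Set ℓ
  FullRank {n} A = ¬ (det n A ≈ 0#)

  UpperTriangular : ∀ {n} → Mat n → Set ℓ
  UpperTriangular A = ∀ i j → j Fin.< i → A i j ≈ 0#

  LowerTriangular : ∀ {n} → Mat n → Set ℓ
  LowerTriangular A = ∀ i j → i Fin.< j → A i j ≈ 0#

  PermMat : ∀ {n} → Permutation′ n → Mat n
  PermMat σ i j with (σ ⟨$⟩ʳ i) Fin.≟ j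
  ... | yes _ = 1#
  ... | no  _ = 0#

  PermTimesLower : ∀ {n} → Mat n → Set (c ⊔ ℓ)
  PermTimesLower {n} A =
    ∃[ σ ] ∃[ L ] (LowerTriangular L × A ≈M PermMat {n} σ ⊗ L)

  Partition : ℕ → Set
  Partition r = Σ (Fin r → ℕ) (λ μ → ∀ i j → i Fin.≤ j → μ j ℕ.≤ μ i)

  Dμ : ∀ {r} → Partition r → Mat r
  Dμ (μ , _) = diag (λ i → t ^ μ i)

  IsInv : ∀ {r} → Mat r → Partition r → Set (c ⊔ ℓ)
  IsInv {r} M μ = ∃[ P ] ∃[ Q ] (GL.mat P ⊗ M ⊗ GL.inv Q ≈M Dμ μ)

  PairEquiv : ∀ {r} → Mat r × Mat r → Mat r × Mat r → Set (c ⊔ ℓ)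
  PairEquiv {r} (M , N) (M' , N') = ∃[ P ] ∃[ Q ] ∃[ T ]
    (M' ≈M GL.mat P ⊗ M ⊗ GL.inv Q × N' ≈M GL.mat Q ⊗ N ⊗ GL.inv T)

  -- Q ∈ GL_r(R) is μ-admissible: D_μ Q D_μ⁻¹ is a matrix over R that is invertible,
  -- i.e. there is A ∈ GL_r(R) with t^{μ_i} Q_ij = A_ij t^{μ_j} (D_μ Q = A D_μ).
  Admissible : ∀ {r} → Partition r → Mat r → Set (c ⊔ ℓ)
  Admissible (μ , _) Q = Invertible Q ×
    ∃[ A ] (Invertible A × (∀ i j → (t ^ μ i) * Q i j ≈ A i j * (t ^ μ j)))

  record IndexSet (r k : ℕ) : Set where
    field
      ix   : Fin k → Fin r
      incr : ∀ a b → a Fin.< b → ix a Fin.< ix b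
  open IndexSet public

  _⊑_ : ∀ {r k} → IndexSet r k → IndexSet r k → Set
  I ⊑ H = ∀ s → ix I s Fin.≤ ix H s

  sub : ∀ {r m} → Mat r → (Fin m → Fin r) → (Fin m → Fin r) → Mat m
  sub W f g a b = W (f a) (g b)

  ‖minor‖ : ∀ {r k} → Mat r → IndexSet r k → IndexSet r k → ℕ∞
  ‖minor‖ {k = k} W I J = ‖ det k (sub W (ix I) (ix J)) ‖

  ∣_∣_ : ∀ {r k} → Partition r → IndexSet r k → ℕ
  ∣_∣_ {k = k} (μ , _) I = sumℕ k (λ s → μ (ix I s))

  record IsGeneric {r} (μ : Partition r) (N* : Mat r) : Set (c ⊔ ℓ) where
    field
      N QU QL TL TU QhL QhU : Mat r
      N-fullRank : FullRank N
      QU-inv     : Invertible QU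
      QL-inv     : Invertible QL
      TL-inv     : Invertible TL
      TU-inv     : Invertible TU
      QU-upper   : UpperTriangular QU
      QU-adm     : Admissible μ QU
      QL-lower   : LowerTriangular QL
      QL-adm     : Admissible μ QL
      TU-upper   : UpperTriangular TU
      TL-perm    : PermTimesLower TL
    Q : Mat r
    Q = QU ⊗ QL
    Tinv : Mat r
    Tinv = TL ⊗ TU
    field
      N*-eq      : N* ≈M Q ⊗ N ⊗ Tinv
      QhL-lower  : LowerTriangular QhL
      QhL-adm    : Admissible μ QhL
      QhU-upper  : UpperTriangular QhU
      QhU-adm    : Admissible μ QhU
      Q-fact     : Q ≈M QhL ⊗ QhU
      QLNTL-upper : UpperTriangular (QL ⊗ N ⊗ TL)
      minors : ∀ k (I J : IndexSet r k) →
        IsMinOf (‖minor‖ (Q ⊗ N ⊗ Tinv) I J) (λ S → I ⊑ S)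
                (λ S → ‖minor‖ (QL ⊗ N ⊗ Tinv) S J)
        × IsMinOf (‖minor‖ (Q ⊗ N ⊗ Tinv) I J) (λ H → H ⊑ I)
                (λ H → ‖minor‖ (QhU ⊗ N ⊗ Tinv) H J +∞ fin ((∣ μ ∣ H) ∸ (∣ μ ∣ I)))
        × IsMinOf (‖minor‖ (Q ⊗ N ⊗ Tinv) I J) (λ H → H ⊑ J)
                (λ H → ‖minor‖ (Q ⊗ N ⊗ TL) I H)

  -- The filling determined by N*.
  -- Rows/columns are numbered 1..r; row ℓ (Fin index) has number suc (toℕ ℓ).

  keptRows : (r a b : ℕ) → List (Fin r)
  keptRows r a b =
    filter (λ l → (suc (toℕ l) ℕ.<? a) ⊎-dec (b ℕ.<? suc (toℕ l))) (allFin r)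

  keptRows-≤ : ∀ r a b → length (keptRows r a b) ℕ.≤ r
  keptRows-≤ r a b = subst (length (keptRows r a b) ℕ.≤_) (length-tabulate (λ x → x))
    (length-filter (λ l → (suc (toℕ l) ℕ.<? a) ⊎-dec (b ℕ.<? suc (toℕ l))) (allFin r))

  -- the right-most m columns: column c ↦ r - m + c
  lastCols : ∀ {r m} → m ℕ.≤ r → Fin m → Fin r
  lastCols m≤r c = opposite (inject≤ (opposite c) m≤r)

  Ω : ∀ {r} → Mat r → ℕ → ℕ → ℕ∞
  Ω {r} N* a b =
    ‖ det (length (keptRows r a b))
          (sub N* (lookup (keptRows r a b)) (lastCols (keptRows-≤ r a b))) ‖

  diff∞ : ℕ∞ → ℕ∞ → Maybe ℤ
  diff∞ (fin x) (fin y) = just (x ℤ.⊖ y)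
  diff∞ _ _ = nothing

  -- partialSum N* i j = k_1j + … + k_ij  (= 0 for i = 0, the empty sum)
  partialSum : ∀ {r} → Mat r → ℕ → ℕ → Maybe ℤ
  partialSum N* zero    j = just (ℤ.+ 0)
  partialSum N* (suc i) j = diff∞ (Ω N* (j ∸ suc i) (j ∸ 1)) (Ω N* (j ∸ suc i ℕ.+ 1) j)

  -- k_ij = (k_1j + … + k_ij) − (k_1j + … + k_(i-1)j); nothing if some order is ∞
  filling : ∀ {r} → Mat r → ℕ → ℕ → Maybe ℤ
  filling N* zero    j = nothing
  filling N* (suc i) j with partialSum N* (suc i) j | partialSum N* i j
  ... | just x | just y = just (x ℤ.- y)
  ... | _      | _      = nothing

{-# OPTIONS --safe #-}
-- For a row set I let g(I) be the order of the minor of N* in rows I and the right-most columns.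
-- The three minimum formulas of genericity give, in this order: g is monotone in I, g(I) + |μ_I|
-- is antitone in I, and g(I) is at most the order of every minor of Q N T_L in rows I.
-- Comparing along the pointwise minimum of I and S, the first two yield
-- g(I) ≤ g(S) + Σ_a max(0, μ_{s_a} − μ_{i_a}) for arbitrary I and S.
-- If N'* = V N* T is a second generic matrix of the same orbit, V is μ-admissible, so t^(μ_s − μ_i)
-- divides V_is. Expanding a minor of V (Q N T_L) (T_U T) in rows I multilinearly in its rows and
-- columns, every term then has order at least g(I): sorting the chosen row indices s does not
-- increase Σ_a max(0, μ_{s_a} − μ_{i_a}), because μ is decreasing. Hence g(I) for N* is at most
-- g(I) for N'*, and by symmetry the two agree; the filling depends only on such minors.
module Submission where

open import Defs
open import Level using (_⊔_)
open import Data.Nat as ℕ using (ℕ; zero; suc; _∸_; _≤_; _<_; z≤n; s≤s; z<s; s<s)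
import Data.Nat.Properties as ℕₚ
open import Data.Nat.Induction using (<-wellFounded)
open import Induction.WellFounded using (Acc; acc)
open import Data.Fin as Fin using (Fin; zero; suc; toℕ; punchIn; opposite)
import Data.Fin.Properties as Finₚ
open import Data.List using (List; _∷_; lookup)
import Data.List.Relation.Unary.All as All
open import Data.List.Relation.Unary.AllPairs using (AllPairs; _∷_)
import Data.List.Relation.Unary.AllPairs.Properties as AllPairsₚ
open import Data.List.Membership.Propositional.Properties using (∈-lookup)
open import Data.Vec.Functional using () renaming (_∷_ to _∷ᶠ_; [] to []ᶠ)
open import Data.Maybe using (just; nothing)
open import Data.Product using (∃-syntax; _×_; _,_; proj₁; proj₂)
open import Data.Sum using (_⊎_; inj₁; inj₂; [_,_]′)
open import Data.Empty using (⊥-elim)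
open import Function using (_∘_)
open import Relation.Nullary using (¬_; yes; no)
open import Relation.Binary.PropositionalEquality as ≡ using (_≡_; cong; cong₂; subst)
import Algebra.Properties.CommutativeSemigroup
import Algebra.Properties.Group
import Algebra.Properties.Ring
import Algebra.Solver.CommutativeMonoid
import Relation.Binary.Reasoning.Setoid

-- Orders and monus

≤∞-refl : ∀ {x} → x ≤∞ x
≤∞-refl {fin _} = fin≤fin ℕₚ.≤-refl
≤∞-refl {∞}     = ≤∞-top _

≤∞-reflexive : ∀ {x y} → x ≡ y → x ≤∞ y
≤∞-reflexive ≡.refl = ≤∞-refl

≤∞-trans : ∀ {x y z} → x ≤∞ y → y ≤∞ z → x ≤∞ z
≤∞-trans (fin≤fin p) (fin≤fin q) = fin≤fin (ℕₚ.≤-trans p q)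
≤∞-trans _           (≤∞-top _)  = ≤∞-top _

≤∞-antisym : ∀ {x y} → x ≤∞ y → y ≤∞ x → x ≡ y
≤∞-antisym (fin≤fin p) (fin≤fin q) = cong fin (ℕₚ.≤-antisym p q)
≤∞-antisym (≤∞-top _)  (≤∞-top _)  = ≡.refl

+∞-mono : ∀ {x y u v} → x ≤∞ y → u ≤∞ v → x +∞ u ≤∞ y +∞ v
+∞-mono (fin≤fin p) (fin≤fin q) = fin≤fin (ℕₚ.+-mono-≤ p q)
+∞-mono {y = fin _} _ (≤∞-top _) = ≤∞-top _
+∞-mono {y = ∞}     _ _          = ≤∞-top _

+∞-assoc : ∀ x m n → (x +∞ fin m) +∞ fin n ≡ x +∞ fin (m ℕ.+ n)
+∞-assoc (fin k) m n = cong fin (ℕₚ.+-assoc k m n)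
+∞-assoc ∞       m n = ≡.refl

+∞-comm : ∀ x y → x +∞ y ≡ y +∞ x
+∞-comm (fin m) (fin n) = cong fin (ℕₚ.+-comm m n)
+∞-comm (fin _) ∞       = ≡.refl
+∞-comm ∞       (fin _) = ≡.refl
+∞-comm ∞       ∞       = ≡.refl

∸-triangle : ∀ a b c → a ∸ c ≤ (a ∸ b) ℕ.+ (b ∸ c)
∸-triangle a b c = ℕₚ.m≤n+o⇒m∸n≤o a c (begin
  a                            ≤⟨ ℕₚ.m≤n+m∸n a b ⟩
  b ℕ.+ (a ∸ b)                ≤⟨ ℕₚ.+-monoˡ-≤ (a ∸ b) (ℕₚ.m≤n+m∸n b c) ⟩
  c ℕ.+ (b ∸ c) ℕ.+ (a ∸ b)    ≡⟨ ℕₚ.+-assoc c (b ∸ c) (a ∸ b) ⟩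
  c ℕ.+ ((b ∸ c) ℕ.+ (a ∸ b))  ≡⟨ cong (c ℕ.+_) (ℕₚ.+-comm (b ∸ c) (a ∸ b)) ⟩
  c ℕ.+ ((a ∸ b) ℕ.+ (b ∸ c))  ∎)
  where open ℕₚ.≤-Reasoning

-- This is convexity of max(0, x): the differences on the two sides have equal sums, and those on
-- the right are the extreme ones. If `j ≤ a`, then `b ∸ j` splits exactly at `a`; otherwise `a ∸ j`
-- vanishes and monotonicity suffices.
∸-exchange : ∀ {a b i j} → a ≤ b → j ≤ i → (b ∸ i) ℕ.+ (a ∸ j) ≤ (a ∸ i) ℕ.+ (b ∸ j)
∸-exchange {a} {b} {i} {j} a≤b j≤i with ℕₚ.≤-total j a
... | inj₁ j≤a = begin
  (b ∸ i) ℕ.+ (a ∸ j)                  ≤⟨ ℕₚ.+-monoˡ-≤ (a ∸ j) (∸-triangle b a i) ⟩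
  (b ∸ a) ℕ.+ (a ∸ i) ℕ.+ (a ∸ j)      ≡⟨ cong (ℕ._+ (a ∸ j)) (ℕₚ.+-comm (b ∸ a) (a ∸ i)) ⟩
  (a ∸ i) ℕ.+ (b ∸ a) ℕ.+ (a ∸ j)      ≡⟨ ℕₚ.+-assoc (a ∸ i) (b ∸ a) (a ∸ j) ⟩
  (a ∸ i) ℕ.+ ((b ∸ a) ℕ.+ (a ∸ j))    ≡⟨ cong ((a ∸ i) ℕ.+_) (ℕₚ.+-∸-assoc (b ∸ a) j≤a) ⟨
  (a ∸ i) ℕ.+ ((b ∸ a) ℕ.+ a ∸ j)      ≡⟨ cong (λ x → (a ∸ i) ℕ.+ (x ∸ j)) (ℕₚ.m∸n+n≡m a≤b) ⟩
  (a ∸ i) ℕ.+ (b ∸ j)                  ∎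
  where open ℕₚ.≤-Reasoning
... | inj₂ a≤j = begin
  (b ∸ i) ℕ.+ (a ∸ j)  ≡⟨ cong ((b ∸ i) ℕ.+_) (ℕₚ.m≤n⇒m∸n≡0 a≤j) ⟩
  (b ∸ i) ℕ.+ 0        ≡⟨ ℕₚ.+-identityʳ (b ∸ i) ⟩
  b ∸ i                ≤⟨ ℕₚ.∸-monoʳ-≤ b j≤i ⟩
  b ∸ j                ≤⟨ ℕₚ.m≤n+m (b ∸ j) (a ∸ i) ⟩
  (a ∸ i) ℕ.+ (b ∸ j)  ∎
  where open ℕₚ.≤-Reasoning

-- Sorting index maps by adjacent swaps

-- A pair of neighbouring positions, shaped so that `there` leaves the first position alone;
-- induction on it follows the expansion of `det` along the first row.
data Adjacent : ℕ → Set where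
  here  : ∀ {n} → Adjacent (suc (suc n))
  there : ∀ {n} → Adjacent n → Adjacent (suc n)

lower upper : ∀ {n} → Adjacent n → Fin n
lower here      = zero
lower (there p) = suc (lower p)
upper here      = suc zero
upper (there p) = suc (upper p)

swap : ∀ {n} → Adjacent n → Fin n → Fin n
swap here      zero          = suc zero
swap here      (suc zero)    = zero
swap here      (suc (suc i)) = suc (suc i)
swap (there p) zero          = zero
swap (there p) (suc i)       = suc (swap p i)

∘-swap-fixed : ∀ {n} {A : Set} (f : Fin n → A) p → f (lower p) ≡ f (upper p) →
               ∀ i → f (swap p i) ≡ f i
∘-swap-fixed f here      eq zero          = ≡.sym eq
∘-swap-fixed f here      eq (suc zero)    = eq
∘-swap-fixed f here      eq (suc (suc i)) = ≡.refl
∘-swap-fixed f (there p) eq zero          = ≡.refl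
∘-swap-fixed f (there p) eq (suc i)       = ∘-swap-fixed (f ∘ suc) p eq i

Increasing : ∀ {k r} → (Fin k → Fin r) → Set
Increasing f = ∀ a b → a Fin.< b → f a Fin.< f b

descentOrIncreasing : ∀ {k r} (f : Fin k → Fin r) →
  (∃[ p ] f (upper p) Fin.≤ f (lower p)) ⊎ Increasing f
descentOrIncreasing {zero} f = inj₂ λ ()
descentOrIncreasing {suc zero} f = inj₂ λ { zero zero () }
descentOrIncreasing {suc (suc k)} f with descentOrIncreasing (f ∘ suc) | f (suc zero) Fin.≤? f zero
... | inj₁ (p , d) | _     = inj₁ (there p , d)
... | inj₂ _       | yes d = inj₁ (here , d)
... | inj₂ inc     | no ¬d = inj₂ increasing
  where
  f0<f1 : f zero Fin.< f (suc zero)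
  f0<f1 = ℕₚ.≰⇒> ¬d
  increasing : Increasing f
  increasing zero    (suc zero)    _         = f0<f1
  increasing zero    (suc (suc b)) _         = ℕₚ.<-trans f0<f1 (inc zero (suc b) z<s)
  increasing (suc a) (suc b)       (s≤s a<b) = inc a b a<b

-- Adding up all partial sums of f gives a quantity that drops when a descent of f is swapped away.
sumOfPartialSums : ∀ {n} → ℕ → (Fin n → ℕ) → ℕ
sumOfPartialSums {zero}  offset f = 0
sumOfPartialSums {suc n} offset f = offset ℕ.+ f zero ℕ.+ sumOfPartialSums (offset ℕ.+ f zero) (f ∘ suc)

swap-descent-< : ∀ {n} offset (f : Fin n → ℕ) p → f (upper p) < f (lower p) →
  sumOfPartialSums offset (f ∘ swap p) < sumOfPartialSums offset f
swap-descent-< offset f here d =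
  ℕₚ.+-mono-<-≤ (ℕₚ.+-monoʳ-< offset d)
    -- Past both positions the running total is the same in either order, so only the partial sum
    -- ending at the first of them drops.
    (ℕₚ.≤-reflexive (cong (λ x → x ℕ.+ sumOfPartialSums x (λ i → f (suc (suc i)))) eq))
  where
  eq : offset ℕ.+ f (suc zero) ℕ.+ f zero ≡ offset ℕ.+ f zero ℕ.+ f (suc zero)
  eq = ≡.trans (ℕₚ.+-assoc offset _ _)
      (≡.trans (cong (offset ℕ.+_) (ℕₚ.+-comm (f (suc zero)) (f zero))) (≡.sym (ℕₚ.+-assoc offset _ _)))
swap-descent-< offset f (there p) d =
  ℕₚ.+-monoʳ-< (offset ℕ.+ f zero) (swap-descent-< (offset ℕ.+ f zero) (f ∘ suc) p d)

-- Separates the cases met when sorting the rows or columns of a determinant: already sorted, two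
-- equal neighbours, and an exchange that alters only the sign. Each exchange strictly lowers
-- `sumOfPartialSums`, so the procedure ends.
bubbleSort-induction : ∀ {k r ℓ} (Φ : (Fin k → Fin r) → Set ℓ) →
  (∀ f → Increasing f → Φ f) →
  (∀ f p → f (lower p) ≡ f (upper p) → Φ f) →
  (∀ f p → f (upper p) Fin.< f (lower p) → Φ (f ∘ swap p) → Φ f) →
  ∀ f → Φ f
bubbleSort-induction Φ sorted repeated descent f = go f (<-wellFounded _)
  where
  go : ∀ f → Acc _<_ (sumOfPartialSums 0 (toℕ ∘ f)) → Φ f
  go f (acc rec) with descentOrIncreasing f
  ... | inj₂ inc = sorted f inc
  ... | inj₁ (p , d) with f (lower p) Fin.≟ f (upper p)
  ...   | yes eq = repeated f p eq
  ...   | no neq = descent f p d′ (go (f ∘ swap p) (rec (swap-descent-< 0 (toℕ ∘ f) p d′)))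
    where
    d′ : f (upper p) Fin.< f (lower p)
    d′ = Finₚ.≤∧≢⇒< d (neq ∘ ≡.sym)

increasing⇒expanding : ∀ {k r} (f : Fin k → Fin r) → Increasing f → ∀ s → toℕ s ≤ toℕ (f s)
increasing⇒expanding {k} f inc s = go (toℕ s) s ≡.refl
  where
  -- The recursion is on the value `n`, since `Fin.inject₁ s` is not a subterm of `suc s`.
  go : ∀ n s → toℕ s ≡ n → n ≤ toℕ (f s)
  go zero    s       _  = z≤n
  go (suc n) (suc s) eq = ℕₚ.≤-trans
    (s≤s (go n (Fin.inject₁ s) (≡.trans (Finₚ.toℕ-inject₁ s) (ℕₚ.suc-injective eq))))
    (inc (Fin.inject₁ s) (suc s) (ℕₚ.≤-reflexive (cong suc (Finₚ.toℕ-inject₁ s))))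

-- Reversal, list lookup and minima of indices

opposite-anti-≤ : ∀ {n} {i j : Fin n} → i Fin.≤ j → opposite j Fin.≤ opposite i
opposite-anti-≤ {n} {i} {j} i≤j = ≡.subst₂ _≤_
  (≡.sym (Finₚ.opposite-prop j)) (≡.sym (Finₚ.opposite-prop i)) (ℕₚ.∸-monoʳ-≤ n (s≤s i≤j))

opposite-anti-< : ∀ {n} {i j : Fin n} → i Fin.< j → opposite j Fin.< opposite i
opposite-anti-< {n} {i} {j} i<j = ≡.subst₂ _<_
  (≡.sym (Finₚ.opposite-prop j)) (≡.sym (Finₚ.opposite-prop i))
  (ℕₚ.∸-monoʳ-< (s<s i<j) (Finₚ.toℕ<n j))

lookup-increasing : ∀ {r} {xs : List (Fin r)} → AllPairs Fin._<_ xs → Increasing (lookup xs)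
lookup-increasing {xs = x ∷ xs} (x<xs ∷ _)  zero    (suc b) _         = All.lookup x<xs (∈-lookup b)
lookup-increasing {xs = x ∷ xs} (_ ∷ pairs) (suc a) (suc b) (s≤s a<b) = lookup-increasing pairs a b a<b

minFin : ∀ {n} → Fin n → Fin n → Fin n
minFin i j with i Fin.≤? j
... | yes _ = i
... | no  _ = j

minFin-≤ˡ : ∀ {n} (i j : Fin n) → minFin i j Fin.≤ i
minFin-≤ˡ i j with i Fin.≤? j
... | yes _   = ℕₚ.≤-refl
... | no  i≰j = ℕₚ.<⇒≤ (ℕₚ.≰⇒> i≰j)

minFin-≤ʳ : ∀ {n} (i j : Fin n) → minFin i j Fin.≤ j
minFin-≤ʳ i j with i Fin.≤? j
... | yes i≤j = i≤j
... | no  _   = ℕₚ.≤-refl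

minFin-sel : ∀ {n} (i j : Fin n) → minFin i j ≡ i ⊎ minFin i j ≡ j
minFin-sel i j with i Fin.≤? j
... | yes _ = inj₁ ≡.refl
... | no  _ = inj₂ ≡.refl

minFin-glb-< : ∀ {n} {x i j : Fin n} → x Fin.< i → x Fin.< j → x Fin.< minFin i j
minFin-glb-< {i = i} {j} x<i x<j with i Fin.≤? j
... | yes _ = x<i
... | no  _ = x<j

-- Determinants

module Determinants {c ℓ} (D : DVR c ℓ) where
  open DVR D hiding (zero)
  open Mats D
  open Algebra.Properties.Ring ring using (-0#≈0#; -‿+-comm; -‿distribˡ-*; -‿distribʳ-*; -‿involutive)
  open Relation.Binary.Reasoning.Setoid setoid
  private
    module +-Solver = Algebra.Solver.CommutativeMonoid +-commutativeMonoid
    module *-Solver = Algebra.Solver.CommutativeMonoid *-commutativeMonoid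

  open *-Solver using () renaming (_⊕_ to _⊕*_; _⊜_ to _⊜*_)
  open +-Solver using () renaming (_⊕_ to _⊕+_; _⊜_ to _⊜+_)

  sumF-cong : ∀ n {f g : Fin n → Carrier} → (∀ i → f i ≈ g i) → sumF n f ≈ sumF n g
  sumF-cong zero    f≈g = refl
  sumF-cong (suc n) f≈g = +-cong (f≈g zero) (sumF-cong n (f≈g ∘ suc))

  sumF-0 : ∀ n → sumF n (λ _ → 0#) ≈ 0#
  sumF-0 zero    = refl
  sumF-0 (suc n) = trans (+-identityˡ _) (sumF-0 n)

  sumF-+ : ∀ n (f g : Fin n → Carrier) → sumF n (λ i → f i + g i) ≈ sumF n f + sumF n g
  sumF-+ zero    f g = sym (+-identityˡ 0#)
  sumF-+ (suc n) f g = trans (+-congˡ (sumF-+ n (f ∘ suc) (g ∘ suc)))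
    (+-Solver.solve 4 (λ a b x y → ((a ⊕+ b) ⊕+ (x ⊕+ y)) ⊜+ ((a ⊕+ x) ⊕+ (b ⊕+ y))) refl _ _ _ _)

  sumF-*ˡ : ∀ n x (f : Fin n → Carrier) → x * sumF n f ≈ sumF n (λ i → x * f i)
  sumF-*ˡ zero    x f = zeroʳ x
  sumF-*ˡ (suc n) x f = trans (distribˡ x _ _) (+-congˡ (sumF-*ˡ n x (f ∘ suc)))

  sumF-*ʳ : ∀ n x (f : Fin n → Carrier) → sumF n f * x ≈ sumF n (λ i → f i * x)
  sumF-*ʳ n x f = trans (*-comm _ x) (trans (sumF-*ˡ n x f) (sumF-cong n (λ i → *-comm x (f i))))

  sumF-neg : ∀ n (f : Fin n → Carrier) → sumF n (λ i → - f i) ≈ - sumF n f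
  sumF-neg zero    f = sym -0#≈0#
  sumF-neg (suc n) f = trans (+-congˡ (sumF-neg n (f ∘ suc))) (-‿+-comm _ _)

  sumF-comm : ∀ m n (f : Fin m → Fin n → Carrier) →
    sumF m (λ i → sumF n (f i)) ≈ sumF n (λ j → sumF m (λ i → f i j))
  sumF-comm zero    n f = sym (sumF-0 n)
  sumF-comm (suc m) n f = trans (+-congˡ (sumF-comm m n (f ∘ suc)))
    (sym (sumF-+ n (f zero) (λ j → sumF m (λ i → f (suc i) j))))

  infix 8 _ᵀ
  _ᵀ : ∀ {n} → Mat n → Mat n
  (A ᵀ) i j = A j i

  minorMat : ∀ {n} → Fin (suc n) → Fin (suc n) → Mat (suc n) → Mat n
  minorMat i j A a b = A (punchIn i a) (punchIn j b)

  sign : ℕ → Carrier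
  sign k = (- 1#) ^ k

  det-cong : ∀ n {A B : Mat n} → A ≈M B → det n A ≈ det n B
  det-cong zero    A≈B = refl
  det-cong (suc n) A≈B = sumF-cong (suc n) λ j → *-congˡ {x = sign (toℕ j)}
    (*-cong (A≈B zero j) (det-cong n λ a b → A≈B (suc a) (punchIn j b)))

  det-congᶜ : ∀ {n m} (A : Fin n → Fin m → Carrier) (g h : Fin n → Fin m) → (∀ b → g b ≡ h b) →
    det n (λ a b → A a (g b)) ≈ det n (λ a b → A a (h b))
  det-congᶜ {n} A g h g≡h = det-cong n λ a b → reflexive (cong (A a) (g≡h b))

  -- Both sides are one double sum. The factor `- 1#`, which in `det-transpose` comes from the sign
  -- at a successor index, moves from the outer index `j` to the outer index `i`.
  sumF-exchange : ∀ m n (s x : Fin m → Carrier) (u y : Fin n → Carrier) (d : Fin m → Fin n → Carrier) →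
    sumF m (λ j → (- 1# * s j) * (x j * sumF n (λ i → u i * (y i * d j i)))) ≈
    sumF n (λ i → (- 1# * u i) * (y i * sumF m (λ j → s j * (x j * d j i))))
  sumF-exchange m n s x u y d = begin
    sumF m (λ j → (- 1# * s j) * (x j * sumF n (λ i → u i * (y i * d j i))))
      ≈⟨ sumF-cong m (λ j → pull n (- 1# * s j) (x j) (λ i → u i * (y i * d j i))) ⟩
    sumF m (λ j → sumF n (λ i → (- 1# * s j) * (x j * (u i * (y i * d j i)))))
      ≈⟨ sumF-comm m n (λ j i → (- 1# * s j) * (x j * (u i * (y i * d j i)))) ⟩
    sumF n (λ i → sumF m (λ j → (- 1# * s j) * (x j * (u i * (y i * d j i)))))
      ≈⟨ sumF-cong n (λ i → sumF-cong m λ j → *-Solver.solve 6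
           (λ e s x u y d → ((e ⊕* s) ⊕* (x ⊕* (u ⊕* (y ⊕* d)))) ⊜* ((e ⊕* u) ⊕* (y ⊕* (s ⊕* (x ⊕* d)))))
             refl (- 1#) (s j) (x j) (u i) (y i) (d j i)) ⟩
    sumF n (λ i → sumF m (λ j → (- 1# * u i) * (y i * (s j * (x j * d j i)))))
      ≈⟨ sumF-cong n (λ i → pull m (- 1# * u i) (y i) (λ j → s j * (x j * d j i))) ⟨
    sumF n (λ i → (- 1# * u i) * (y i * sumF m (λ j → s j * (x j * d j i)))) ∎
    where
    pull : ∀ n a b (f : Fin n → Carrier) → a * (b * sumF n f) ≈ sumF n (λ i → a * (b * f i))
    pull n a b f = trans (*-congˡ (sumF-*ˡ n b f)) (sumF-*ˡ n a (λ i → b * f i))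

  -- Expanding along the first row and then along the first columns of the minors
  -- is symmetric in rows and columns.
  det-transpose : ∀ n (A : Mat n) → det n (A ᵀ) ≈ det n A
  det-transpose zero          A = refl
  det-transpose (suc zero)    A = refl
  det-transpose (suc (suc n)) A = +-cong (*-congˡ (*-congˡ (det-transpose (suc n) (minorMat zero zero A)))) (begin
    sumF (suc n) (λ i → σ (suc i) * (A (suc i) zero * det (suc n) (minorMat zero (suc i) (A ᵀ))))
      ≈⟨ sumF-cong (suc n) (λ i → *-congˡ {x = σ (suc i)} (*-congˡ {x = A (suc i) zero}
           (det-transpose (suc n) (minorMat zero (suc i) (A ᵀ))))) ⟨
    sumF (suc n) (λ i → σ (suc i) * (A (suc i) zero * sumF (suc n) (λ j → σ j * (A zero (suc j) * d j i))))
      ≈⟨ sumF-exchange (suc n) (suc n) σ (λ i → A (suc i) zero) σ (λ j → A zero (suc j)) (λ i j → d j i) ⟩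
    sumF (suc n) (λ j → σ (suc j) * (A zero (suc j) * sumF (suc n) (λ i → σ i * (A (suc i) zero * d j i))))
      ≈⟨ sumF-cong (suc n) (λ j → *-congˡ {x = σ (suc j)} (*-congˡ {x = A zero (suc j)} (sumF-cong (suc n) λ i →
           *-congˡ {x = σ i} (*-congˡ {x = A (suc i) zero}
             (det-transpose n (λ a b → A (suc (punchIn i a)) (suc (punchIn j b)))))))) ⟨
    sumF (suc n) (λ j → σ (suc j) * (A zero (suc j) * det (suc n) ((minorMat zero (suc j) A) ᵀ)))
      ≈⟨ sumF-cong (suc n) (λ j → *-congˡ {x = σ (suc j)} (*-congˡ {x = A zero (suc j)}
           (det-transpose (suc n) (minorMat zero (suc j) A)))) ⟩
    sumF (suc n) (λ j → σ (suc j) * (A zero (suc j) * det (suc n) (minorMat zero (suc j) A))) ∎)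
    where
    σ : ∀ {m} → Fin m → Carrier
    σ i = sign (toℕ i)
    d : Fin (suc n) → Fin (suc n) → Carrier
    d j i = det n (λ a b → A (suc (punchIn i a)) (suc (punchIn j b)))

  -- Sign changes under swaps

  *-neg-cong : ∀ a b {x y} → x ≈ - y → a * (b * x) ≈ - (a * (b * y))
  *-neg-cong a b {x} {y} x≈-y = begin
    a * (b * x)      ≈⟨ *-congˡ (*-congˡ x≈-y) ⟩
    a * (b * - y)    ≈⟨ *-congˡ (-‿distribʳ-* b y) ⟨
    a * - (b * y)    ≈⟨ -‿distribʳ-* a (b * y) ⟨
    - (a * (b * y))  ∎

  neg-swap : ∀ x y z → x + (- y + - z) ≈ - (y + (- x + z))
  neg-swap x y z = begin
    x + (- y + - z)      ≈⟨ +-Solver.solve 3 (λ x y z → (x ⊕+ (y ⊕+ z)) ⊜+ (y ⊕+ (x ⊕+ z))) refl x (- y) (- z) ⟩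
    - y + (x + - z)      ≈⟨ +-congˡ (+-congʳ (-‿involutive x)) ⟨
    - y + (- - x + - z)  ≈⟨ +-congˡ (-‿+-comm (- x) z) ⟩
    - y + - (- x + z)    ≈⟨ -‿+-comm y (- x + z) ⟩
    - (y + (- x + z))    ∎

  mutual
    -- In the expansion along the first row, the terms of the first two columns trade places and
    -- hence signs, with the same minors. Every other minor still contains both columns and changes
    -- sign by induction.
    det-swap-first-columns : ∀ {n} (A : Mat (suc (suc n))) →
      det _ (λ a b → A a (swap here b)) ≈ - det _ A
    det-swap-first-columns {n} A = begin
      1# * (A zero (suc zero) * d₁′) + (- 1# * 1# * (A zero zero * d₀′) + tail′)
        ≈⟨ +-cong (*-congˡ (*-congˡ (det-congᶜ (A ∘ suc) (swap here ∘ suc) (punchIn (suc zero)) λ { zero → ≡.refl ; (suc b) → ≡.refl })))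
                  (+-cong (*-congˡ (*-congˡ (det-congᶜ (A ∘ suc) (swap here ∘ punchIn (suc zero)) (punchIn zero) λ { zero → ≡.refl ; (suc b) → ≡.refl })))
                    (trans (sumF-cong n (λ j → *-neg-cong (sign (suc (suc (toℕ j)))) (A zero (suc (suc j)))
                       (det-swap-minor A j)))
                       (sumF-neg n (λ j → sign (suc (suc (toℕ j))) * (A zero (suc (suc j)) * det (suc n) (minorMat zero (suc (suc j)) A)))))) ⟩
      1# * (A zero (suc zero) * d₁) + (- 1# * 1# * (A zero zero * d₀) + - tail)
        ≈⟨ +-cong (*-identityˡ _) (+-congʳ (trans (*-congʳ (*-identityʳ (- 1#))) (sym (-‿distribˡ-* 1# _)))) ⟩
      A zero (suc zero) * d₁ + (- (1# * (A zero zero * d₀)) + - tail)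
        ≈⟨ neg-swap _ _ _ ⟩
      - (1# * (A zero zero * d₀) + (- (A zero (suc zero) * d₁) + tail))
        ≈⟨ -‿cong (+-congˡ (+-congʳ (trans (-‿cong (sym (*-identityˡ _))) (trans (-‿distribˡ-* 1# _) (*-congʳ (sym (*-identityʳ _))))))) ⟩
      - (1# * (A zero zero * d₀) + (- 1# * 1# * (A zero (suc zero) * d₁) + tail)) ∎
      where
      d₀ d₁ d₀′ d₁′ tail tail′ : Carrier
      d₀ = det (suc n) (minorMat zero zero A)
      d₁ = det (suc n) (minorMat zero (suc zero) A)
      d₁′ = det (suc n) (λ a b → A (suc a) (swap here (suc b)))
      d₀′ = det (suc n) (λ a b → A (suc a) (swap here (punchIn (suc zero) b)))
      tail = sumF n (λ j → sign (suc (suc (toℕ j))) * (A zero (suc (suc j)) * det (suc n) (minorMat zero (suc (suc j)) A)))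
      tail′ = sumF n (λ j → sign (suc (suc (toℕ j))) * (A zero (suc (suc j)) *
                det (suc n) (λ a b → A (suc a) (swap here (punchIn (suc (suc j)) b)))))

    -- A later column can be deleted before or after the swap, because `swap here` commutes with
    -- `punchIn (suc (suc j))`. The index `j` forces `n` to be a successor, so the minor is again
    -- large enough for the swap.
    det-swap-minor : ∀ {n} (A : Mat (suc (suc n))) (j : Fin n) →
      det (suc n) (λ a b → A (suc a) (swap here (punchIn (suc (suc j)) b))) ≈
      - det (suc n) (minorMat zero (suc (suc j)) A)
    det-swap-minor {suc n} A j = trans
      (det-congᶜ (A ∘ suc) (swap here ∘ punchIn (suc (suc j))) (punchIn (suc (suc j)) ∘ swap here)
        λ { zero → ≡.refl ; (suc zero) → ≡.refl ; (suc (suc b)) → ≡.refl })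
      (det-swap-first-columns (minorMat zero (suc (suc j)) A))

  -- The first two rows are treated as columns of the transpose; a swap further down is inherited by
  -- the minors of the expansion along the untouched first row.
  det-swap-rows : ∀ {n} (p : Adjacent n) (A : Mat n) → det n (A ∘ swap p) ≈ - det n A
  det-swap-rows here A = begin
    det _ (A ∘ swap here)                    ≈⟨ det-transpose _ (A ∘ swap here) ⟨
    det _ (λ a b → (A ᵀ) a (swap here b))    ≈⟨ det-swap-first-columns (A ᵀ) ⟩
    - det _ (A ᵀ)                            ≈⟨ -‿cong (det-transpose _ A) ⟩
    - det _ A                                ∎
  det-swap-rows {suc n} (there p) A = trans
    (sumF-cong (suc n) λ j → *-neg-cong (sign (toℕ j)) (A zero j) (det-swap-rows p (minorMat zero j A)))
    (sumF-neg (suc n) (λ j → sign (toℕ j) * (A zero j * det n (minorMat zero j A))))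

  x≈-x⇒x≈0 : ResidueChar0 D → ∀ {x} → x ≈ - x → x ≈ 0#
  x≈-x⇒x≈0 char0 {x} x≈-x with domain (1# + 1#) x (begin
      (1# + 1#) * x    ≈⟨ distribʳ x 1# 1# ⟩
      1# * x + 1# * x  ≈⟨ +-cong (*-identityˡ x) (*-identityˡ x) ⟩
      x + x            ≈⟨ +-congˡ x≈-x ⟩
      x + - x          ≈⟨ -‿inverseʳ x ⟩
      0#               ∎)
  ... | inj₂ x≈0 = x≈0
  -- If 2 were `0#`, it would equal `t * 0#`, against residue characteristic zero. The argument is 1
  -- because `ResidueChar0` speaks of `natR (suc n)`.
  ... | inj₁ 2≈0 = ⊥-elim (char0 1 (0# , trans (+-congˡ (+-identityʳ 1#)) (trans 2≈0 (sym (zeroʳ t)))))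

  -- Swapping equal neighbouring rows leaves the matrix as it is and negates the determinant, which
  -- is therefore its own negative.
  det-equal-rows : ResidueChar0 D → ∀ {n r} (A : Fin r → Fin n → Carrier) (f : Fin n → Fin r) p →
    f (lower p) ≡ f (upper p) → det n (A ∘ f) ≈ 0#
  det-equal-rows char0 {n} A f p eq = x≈-x⇒x≈0 char0 (trans
    (det-cong n λ a b → reflexive (cong (λ i → A i b) (≡.sym (∘-swap-fixed f p eq a))))
    (det-swap-rows p (A ∘ f)))

  -- Multilinear expansion of determinants

  sumMaps : ∀ k r → ((Fin k → Fin r) → Carrier) → Carrier
  sumMaps zero    r Φ = Φ []ᶠ
  sumMaps (suc k) r Φ = sumF r (λ s → sumMaps k r (λ f → Φ (s ∷ᶠ f)))

  sumMaps-cong : ∀ k {r} {Φ Ψ : (Fin k → Fin r) → Carrier} → (∀ f → Φ f ≈ Ψ f) → sumMaps k r Φ ≈ sumMaps k r Ψ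
  sumMaps-cong zero    Φ≈Ψ = Φ≈Ψ []ᶠ
  sumMaps-cong (suc k) Φ≈Ψ = sumF-cong _ λ s → sumMaps-cong k λ f → Φ≈Ψ (s ∷ᶠ f)

  sumMaps-*ˡ : ∀ k {r} x (Φ : (Fin k → Fin r) → Carrier) → x * sumMaps k r Φ ≈ sumMaps k r (λ f → x * Φ f)
  sumMaps-*ˡ zero        x Φ = refl
  sumMaps-*ˡ (suc k) {r} x Φ = trans (sumF-*ˡ r x (λ s → sumMaps k r (λ f → Φ (s ∷ᶠ f))))
    (sumF-cong r λ s → sumMaps-*ˡ k x λ f → Φ (s ∷ᶠ f))

  sumMaps-sumF : ∀ k {r} n (Φ : Fin n → (Fin k → Fin r) → Carrier) →
    sumMaps k r (λ f → sumF n (λ j → Φ j f)) ≈ sumF n (λ j → sumMaps k r (Φ j))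
  sumMaps-sumF zero        n Φ = refl
  sumMaps-sumF (suc k) {r} n Φ = trans
    (sumF-cong r λ s → sumMaps-sumF k n λ j f → Φ j (s ∷ᶠ f))
    (sumF-comm r n λ s j → sumMaps k r (λ f → Φ j (s ∷ᶠ f)))

  prodF : ∀ k → (Fin k → Carrier) → Carrier
  prodF zero    x = 1#
  prodF (suc k) x = x zero * prodF k (x ∘ suc)

  -- The Cauchy-Binet expansion before maps are grouped by their image: repeated and unsorted
  -- choices stay separate, since the later estimate is made term by term. Rows are chosen one at a
  -- time, in step with the recursion of `det`.
  det-expand-rows : ∀ k r (P : Fin k → Fin r → Carrier) (Y : Fin r → Fin k → Carrier) →
    det k (λ a b → sumF r (λ s → P a s * Y s b)) ≈
    sumMaps k r (λ f → prodF k (λ a → P a (f a)) * det k (Y ∘ f))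
  det-expand-rows zero    r P Y = sym (*-identityˡ 1#)
  det-expand-rows (suc k) r P Y = begin
    sumF (suc k) (λ j → σ j * (sumF r (λ s → P zero s * Y s j) *
      det k (λ a b → sumF r (λ s → P (suc a) s * Y s (punchIn j b)))))
      ≈⟨ sumF-cong (suc k) (λ j → *-congˡ {x = σ j} (*-congˡ {x = sumF r (λ s → P zero s * Y s j)}
           (det-expand-rows k r (P ∘ suc) (λ s b → Y s (punchIn j b))))) ⟩
    sumF (suc k) (λ j → σ j * (sumF r (λ s → P zero s * Y s j) * sumMaps k r (λ f → π f * d j f)))
      ≈⟨ sumF-cong (suc k) distribute ⟩
    sumF (suc k) (λ j → sumF r (λ s → sumMaps k r (term s j)))
      ≈⟨ sumF-comm (suc k) r (λ j s → sumMaps k r (term s j)) ⟩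
    sumF r (λ s → sumF (suc k) (λ j → sumMaps k r (term s j)))
      -- Read backwards, the sum over `j` is the first-row expansion of the determinant with rows
      -- chosen by `s ∷ᶠ f`.
      ≈⟨ sumF-cong r (λ s → trans
           (sumMaps-cong k λ f → sumF-*ˡ (suc k) (P zero s * π f) (λ j → σ j * (Y s j * d j f)))
           (sumMaps-sumF k (suc k) (term s))) ⟨
    sumF r (λ s → sumMaps k r (λ f → (P zero s * π f) * sumF (suc k) (λ j → σ j * (Y s j * d j f)))) ∎
    where
    σ : Fin (suc k) → Carrier
    σ j = sign (toℕ j)
    π : (Fin k → Fin r) → Carrier
    π f = prodF k (λ a → P (suc a) (f a))
    d : Fin (suc k) → (Fin k → Fin r) → Carrier
    d j f = det k (λ a b → Y (f a) (punchIn j b))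
    term : Fin r → Fin (suc k) → (Fin k → Fin r) → Carrier
    term s j f = (P zero s * π f) * (σ j * (Y s j * d j f))
    distribute : ∀ j → σ j * (sumF r (λ s → P zero s * Y s j) * sumMaps k r (λ f → π f * d j f)) ≈
                 sumF r (λ s → sumMaps k r (term s j))
    distribute j = begin
      σ j * (sumF r (λ s → P zero s * Y s j) * E)
        ≈⟨ *-congˡ (sumF-*ʳ r E (λ s → P zero s * Y s j)) ⟩
      σ j * sumF r (λ s → (P zero s * Y s j) * E)
        ≈⟨ sumF-*ˡ r (σ j) (λ s → (P zero s * Y s j) * E) ⟩
      sumF r (λ s → σ j * ((P zero s * Y s j) * E))
        ≈⟨ sumF-cong r (λ s → trans (sym (*-assoc (σ j) (P zero s * Y s j) E))
             (trans (sumMaps-*ˡ k (σ j * (P zero s * Y s j)) (λ f → π f * d j f))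
               (sumMaps-cong k λ f → *-Solver.solve 5
                 (λ σ p y π d → ((σ ⊕* (p ⊕* y)) ⊕* (π ⊕* d)) ⊜* ((p ⊕* π) ⊕* (σ ⊕* (y ⊕* d)))) refl
                 (σ j) (P zero s) (Y s j) (π f) (d j f)))) ⟩
      sumF r (λ s → sumMaps k r (term s j)) ∎
      where
      E : Carrier
      E = sumMaps k r (λ f → π f * d j f)

-- Orders of ring elements, and matrices up to pair equivalence

module Orders {c ℓ} (D : DVR c ℓ) where
  open DVR D hiding (zero)
  open Mats D
  open Determinants D
  open Algebra.Properties.Ring ring using (-‿distribʳ-*; -‿involutive; -1*x≈-x)
  open Algebra.Properties.Group +-group using (x∙y⁻¹≈ε⇒x≈y)
  open Relation.Binary.Reasoning.Setoid setoid
  private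
    module *-Solver = Algebra.Solver.CommutativeMonoid *-commutativeMonoid
  open *-Solver using () renaming (_⊕_ to _⊕*_; _⊜_ to _⊜*_)

  ^-+ : ∀ x m n → x ^ (m ℕ.+ n) ≈ (x ^ m) * (x ^ n)
  ^-+ x zero    n = sym (*-identityˡ _)
  ^-+ x (suc m) n = trans (*-congˡ (^-+ x m n)) (sym (*-assoc x _ _))

  t^-nonzero : ∀ n → ¬ (t ^ n ≈ 0#)
  t^-nonzero zero    eq = nontrivial eq
  t^-nonzero (suc n) eq = [ t-nonzero , t^-nonzero n ]′ (domain t (t ^ n) eq)

  t^-cancelˡ : ∀ n {x y} → (t ^ n) * x ≈ (t ^ n) * y → x ≈ y
  t^-cancelˡ n {x} {y} eq with domain (t ^ n) (x + - y) (begin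
      (t ^ n) * (x + - y)              ≈⟨ distribˡ (t ^ n) x (- y) ⟩
      (t ^ n) * x + (t ^ n) * - y      ≈⟨ +-cong eq (sym (-‿distribʳ-* (t ^ n) y)) ⟩
      (t ^ n) * y + - ((t ^ n) * y)    ≈⟨ -‿inverseʳ _ ⟩
      0#                               ∎)
  ... | inj₁ t^n≈0 = ⊥-elim (t^-nonzero n t^n≈0)
  ... | inj₂ x-y≈0 = x∙y⁻¹≈ε⇒x≈y x y x-y≈0

  infix 4 _∣∞_
  -- Lower bounds on `ord` are carried as divisibility by powers of `t`, with `∞` for being zero,
  -- because this form passes directly through sums and products; `ord∣∞` and `∣∞⇒≤ord` translate
  -- back and forth.
  data _∣∞_ : ℕ∞ → Carrier → Set (c ⊔ ℓ) where
    fin∣ : ∀ {n a} y → a ≈ (t ^ n) * y → fin n ∣∞ a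
    ∞∣   : ∀ {a} → a ≈ 0# → ∞ ∣∞ a

  ∣∞-resp-≈ : ∀ {x a b} → a ≈ b → x ∣∞ a → x ∣∞ b
  ∣∞-resp-≈ a≈b (fin∣ y eq) = fin∣ y (trans (sym a≈b) eq)
  ∣∞-resp-≈ a≈b (∞∣ eq)     = ∞∣ (trans (sym a≈b) eq)

  ∣∞-0 : ∀ {x a} → a ≈ 0# → x ∣∞ a
  ∣∞-0 {fin _} a≈0 = fin∣ 0# (trans a≈0 (sym (zeroʳ _)))
  ∣∞-0 {∞}     a≈0 = ∞∣ a≈0

  ∣∞-+ : ∀ {x a b} → x ∣∞ a → x ∣∞ b → x ∣∞ (a + b)
  ∣∞-+ (fin∣ y p) (fin∣ z q) = fin∣ (y + z) (trans (+-cong p q) (sym (distribˡ _ y z)))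
  ∣∞-+ (∞∣ p)     (∞∣ q)     = ∞∣ (trans (+-cong p q) (+-identityˡ 0#))

  ∣∞-* : ∀ {x y a b} → x ∣∞ a → y ∣∞ b → (x +∞ y) ∣∞ (a * b)
  ∣∞-* (fin∣ {m} u p) (fin∣ {n} v q) = fin∣ (u * v) (trans (*-cong p q) (trans
    (*-Solver.solve 4 (λ s u r v → ((s ⊕* u) ⊕* (r ⊕* v)) ⊜* ((s ⊕* r) ⊕* (u ⊕* v))) refl (t ^ m) u (t ^ n) v)
    (*-congʳ (sym (^-+ t m n)))))
  ∣∞-* (fin∣ _ _) (∞∣ q) = ∞∣ (trans (*-congˡ q) (zeroʳ _))
  ∣∞-* (∞∣ p)     _      = ∞∣ (trans (*-congʳ p) (zeroˡ _))

  1∣∞ : ∀ a → fin 0 ∣∞ a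
  1∣∞ a = fin∣ a (sym (*-identityˡ a))

  ∣∞-antitone : ∀ {x y a} → x ≤∞ y → y ∣∞ a → x ∣∞ a
  ∣∞-antitone (fin≤fin {m} m≤n) (fin∣ {n} u p) = fin∣ ((t ^ (n ∸ m)) * u) (trans p (trans
    (*-congʳ (trans (reflexive (cong (t ^_) (≡.sym (ℕₚ.m+[n∸m]≡n m≤n)))) (^-+ t m (n ∸ m))))
    (*-assoc _ _ u)))
  ∣∞-antitone (≤∞-top _) (∞∣ p) = ∣∞-0 p

  ∣∞-*ˡ : ∀ {x b} a → x ∣∞ b → x ∣∞ (a * b)
  ∣∞-*ˡ a x∣b = ∣∞-antitone (≤∞-reflexive (0+∞ _)) (∣∞-* (1∣∞ a) x∣b)
    where
    0+∞ : ∀ x → x ≡ fin 0 +∞ x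
    0+∞ (fin _) = ≡.refl
    0+∞ ∞       = ≡.refl

  ∣∞-neg : ∀ {x a} → x ∣∞ a → x ∣∞ (- a)
  ∣∞-neg {a = a} x∣a = ∣∞-resp-≈ (-1*x≈-x a) (∣∞-*ˡ (- 1#) x∣a)

  ord∣∞ : ∀ a → ord a ∣∞ a
  ord∣∞ a = go (ord a) ≡.refl
    where
    go : ∀ x → ord a ≡ x → x ∣∞ a
    go ∞       eq = ∞∣ (ord-∞ a eq)
    go (fin k) eq = let u , _ , a≈ut^k = ord-fin a k eq in fin∣ u (trans a≈ut^k (*-comm u _))

  -- With `a ≈ u * (t ^ k)` and `u` a unit, divisibility by a power beyond `k` would, after
  -- cancelling `t ^ k`, make `t` divide `u` and so be a unit itself.
  ∣∞⇒≤ord : ∀ {x a} → x ∣∞ a → x ≤∞ ord a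
  ∣∞⇒≤ord {x} {a} x∣a = go (ord a) ≡.refl
    where
    go : ∀ y → ord a ≡ y → x ≤∞ y
    go ∞       _  = ≤∞-top _
    go (fin k) eq with ord-fin a k eq
    ... | u , (v , uv≈1) , a≈ut^k = bound x∣a
      where
      bound : ∀ {x} → x ∣∞ a → x ≤∞ fin k
      bound (∞∣ a≈0) = ⊥-elim (t^-nonzero k (begin
        t ^ k              ≈⟨ *-identityˡ _ ⟨
        1# * (t ^ k)       ≈⟨ *-congʳ uv≈1 ⟨
        (u * v) * (t ^ k)  ≈⟨ *-Solver.solve 3 (λ u v s → ((u ⊕* v) ⊕* s) ⊜* (v ⊕* (u ⊕* s))) refl u v (t ^ k) ⟩
        v * (u * (t ^ k))  ≈⟨ *-congˡ (trans (sym a≈ut^k) a≈0) ⟩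
        v * 0#             ≈⟨ zeroʳ v ⟩
        0#                 ∎))
      bound (fin∣ {n} y a≈t^ny) with n ℕ.≤? k
      ... | yes n≤k = fin≤fin n≤k
      -- Here `z * v` is the inverse of `t`; `m` counts the factors of `t` left in `t ^ n` after `k`
      -- are cancelled and one more is split off.
      ... | no  n≰k = ⊥-elim (t-nonunit (z * v , trans (sym (*-assoc t z v)) (trans (*-congʳ (sym u≈tz)) uv≈1)))
        where
        m : ℕ
        m = n ∸ suc k
        z : Carrier
        z = (t ^ m) * y
        u≈tz : u ≈ t * z
        u≈tz = t^-cancelˡ k (begin
          (t ^ k) * u                  ≈⟨ *-comm _ u ⟩
          u * (t ^ k)                  ≈⟨ a≈ut^k ⟨
          a                            ≈⟨ a≈t^ny ⟩
          (t ^ n) * y                  ≈⟨ *-congʳ (reflexive (cong (t ^_) (≡.sym (ℕₚ.m+[n∸m]≡n (ℕₚ.≰⇒> n≰k))))) ⟩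
          (t * (t ^ (k ℕ.+ m))) * y    ≈⟨ *-congʳ (*-congˡ (^-+ t k m)) ⟩
          (t * ((t ^ k) * (t ^ m))) * y
            ≈⟨ *-Solver.solve 4 (λ t s r y → ((t ⊕* (s ⊕* r)) ⊕* y) ⊜* (s ⊕* (t ⊕* (r ⊕* y)))) refl t (t ^ k) (t ^ m) y ⟩
          (t ^ k) * (t * z)            ∎)

  -- `ord a` is the largest exponent dividing `a` in the sense of `_∣∞_`, and that divisibility
  -- respects `_≈_`.
  ord-cong : ∀ {a b} → a ≈ b → ord a ≡ ord b
  ord-cong {a} {b} a≈b = ≤∞-antisym (∣∞⇒≤ord (∣∞-resp-≈ a≈b (ord∣∞ a))) (∣∞⇒≤ord (∣∞-resp-≈ (sym a≈b) (ord∣∞ b)))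

  ord-neg-cong : ∀ {a b} → a ≈ - b → ord a ≡ ord b
  ord-neg-cong {a} {b} a≈-b = ≤∞-antisym
    (∣∞⇒≤ord (∣∞-resp-≈ (trans (-‿cong a≈-b) (-‿involutive b)) (∣∞-neg (ord∣∞ a))))
    (∣∞⇒≤ord (∣∞-resp-≈ (sym a≈-b) (∣∞-neg (ord∣∞ b))))

  ≤ord-0 : ∀ {x a} → a ≈ 0# → x ≤∞ ord a
  ≤ord-0 a≈0 = ∣∞⇒≤ord (∣∞-0 a≈0)

  ∣∞-sumF : ∀ n {x} {f : Fin n → Carrier} → (∀ i → x ∣∞ f i) → x ∣∞ sumF n f
  ∣∞-sumF zero    x∣f = ∣∞-0 refl
  ∣∞-sumF (suc n) x∣f = ∣∞-+ (x∣f zero) (∣∞-sumF n (x∣f ∘ suc))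

  ∣∞-sumMaps : ∀ k {r x} {Φ : (Fin k → Fin r) → Carrier} → (∀ f → x ∣∞ Φ f) → x ∣∞ sumMaps k r Φ
  ∣∞-sumMaps zero        x∣Φ = x∣Φ []ᶠ
  ∣∞-sumMaps (suc k) {r} x∣Φ = ∣∞-sumF r λ s → ∣∞-sumMaps k λ f → x∣Φ (s ∷ᶠ f)

  ∣∞-prodF : ∀ k (n : Fin k → ℕ) {x : Fin k → Carrier} → (∀ a → fin (n a) ∣∞ x a) → fin (sumℕ k n) ∣∞ prodF k x
  ∣∞-prodF zero    n n∣x = 1∣∞ 1#
  ∣∞-prodF (suc k) n n∣x = ∣∞-* (n∣x zero) (∣∞-prodF k (n ∘ suc) (n∣x ∘ suc))

  -- Matrix algebra and pair equivalence

  ⊗-cong : ∀ {n} {A A′ B B′ : Mat n} → A ≈M A′ → B ≈M B′ → A ⊗ B ≈M A′ ⊗ B′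
  ⊗-cong {n} p q i j = sumF-cong n λ k → *-cong (p i k) (q k j)

  ≈M-refl : ∀ {n} {A : Mat n} → A ≈M A
  ≈M-refl i j = refl

  ≈M-sym : ∀ {n} {A B : Mat n} → A ≈M B → B ≈M A
  ≈M-sym p i j = sym (p i j)

  ≈M-trans : ∀ {n} {A B C : Mat n} → A ≈M B → B ≈M C → A ≈M C
  ≈M-trans p q i j = trans (p i j) (q i j)

  ⊗-assoc : ∀ {n} (A B C : Mat n) → (A ⊗ B) ⊗ C ≈M A ⊗ (B ⊗ C)
  ⊗-assoc {n} A B C i j = begin
    sumF n (λ k → sumF n (λ l → A i l * B l k) * C k j)
      ≈⟨ sumF-cong n (λ k → sumF-*ʳ n (C k j) (λ l → A i l * B l k)) ⟩
    sumF n (λ k → sumF n (λ l → (A i l * B l k) * C k j))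
      ≈⟨ sumF-comm n n (λ k l → (A i l * B l k) * C k j) ⟩
    sumF n (λ l → sumF n (λ k → (A i l * B l k) * C k j))
      ≈⟨ sumF-cong n (λ l → trans (sumF-cong n λ k → *-assoc (A i l) (B l k) (C k j))
                                  (sym (sumF-*ˡ n (A i l) (λ k → B l k * C k j)))) ⟩
    sumF n (λ l → A i l * sumF n (λ k → B l k * C k j)) ∎

  diag-suc : ∀ {n} (d : Fin (suc n) → Carrier) i j → diag d (suc i) (suc j) ≈ diag (d ∘ suc) i j
  diag-suc d i j with i Fin.≟ j
  ... | yes _ = refl
  ... | no  _ = refl

  diag-⊗ : ∀ {n} (d : Fin n → Carrier) (B : Mat n) i j → (diag d ⊗ B) i j ≈ d i * B i j
  diag-⊗ d B i j = pick d i (λ k → B k j)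
    where
    pick : ∀ {n} (d : Fin n → Carrier) i (x : Fin n → Carrier) → sumF n (λ k → diag d i k * x k) ≈ d i * x i
    pick {suc n} d zero x = trans
      (+-congˡ (trans (sumF-cong n λ k → zeroˡ (x (suc k))) (sumF-0 n))) (+-identityʳ _)
    pick {suc n} d (suc i) x = trans (+-cong (zeroˡ (x zero))
      (trans (sumF-cong n λ k → *-congʳ (diag-suc d i k)) (pick (d ∘ suc) i (x ∘ suc)))) (+-identityˡ _)

  ⊗-diag : ∀ {n} (A : Mat n) (d : Fin n → Carrier) i j → (A ⊗ diag d) i j ≈ A i j * d j
  ⊗-diag A d i j = pick d j (A i)
    where
    pick : ∀ {n} (d : Fin n → Carrier) j (x : Fin n → Carrier) → sumF n (λ k → x k * diag d k j) ≈ x j * d j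
    pick {suc n} d zero x = trans
      (+-congˡ (trans (sumF-cong n λ k → zeroʳ (x (suc k))) (sumF-0 n))) (+-identityʳ _)
    pick {suc n} d (suc j) x = trans (+-cong (zeroʳ (x zero))
      (trans (sumF-cong n λ k → *-congˡ (diag-suc d k j)) (pick (d ∘ suc) j (x ∘ suc)))) (+-identityˡ _)

  ⊗-identityˡ : ∀ {n} (A : Mat n) → Id ⊗ A ≈M A
  ⊗-identityˡ A i j = trans (diag-⊗ (λ _ → 1#) A i j) (*-identityˡ _)

  ⊗-identityʳ : ∀ {n} (A : Mat n) → A ⊗ Id ≈M A
  ⊗-identityʳ A i j = trans (⊗-diag A (λ _ → 1#) i j) (*-identityʳ _)

  ⊗-cancelˡ : ∀ {n} {A B : Mat n} (C : Mat n) → A ⊗ B ≈M Id → A ⊗ (B ⊗ C) ≈M C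
  ⊗-cancelˡ {A = A} {B} C AB≈1 = ≈M-trans (≈M-sym (⊗-assoc A B C)) (≈M-trans (⊗-cong AB≈1 ≈M-refl) (⊗-identityˡ C))

  ⊗-cancelʳ : ∀ {n} {A B : Mat n} (C : Mat n) → A ⊗ B ≈M Id → (C ⊗ A) ⊗ B ≈M C
  ⊗-cancelʳ {A = A} {B} C AB≈1 = ≈M-trans (⊗-assoc C A B) (≈M-trans (⊗-cong ≈M-refl AB≈1) (⊗-identityʳ C))

  -- One-sided form of pair equivalence that makes no use of inverses.
  Transforms : ∀ {r} → Mat r × Mat r → Mat r × Mat r → Set (c ⊔ ℓ)
  Transforms (M , N) (M′ , N′) = ∃[ P ] ∃[ Q ] ∃[ T ] (M′ ⊗ Q ≈M P ⊗ M × N′ ≈M (Q ⊗ N) ⊗ T)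

  transforms : ∀ {r} {X Y : Mat r × Mat r} → PairEquiv X Y → Transforms X Y
  transforms {X = M , N} (P , Q , T , M′≈ , N′≈) =
    GL.mat P , GL.mat Q , GL.inv T ,
    ≈M-trans (⊗-cong M′≈ ≈M-refl) (⊗-cancelʳ (GL.mat P ⊗ M) (GL.inv-mat Q)) , N′≈

  transforms⁻¹ : ∀ {r} {X Y : Mat r × Mat r} → PairEquiv X Y → Transforms Y X
  transforms⁻¹ {X = M , N} {M′ , N′} (P , Q , T , M′≈ , N′≈) =
    GL.inv P , GL.inv Q , GL.mat T ,
    ≈M-sym (≈M-trans (⊗-cong ≈M-refl (≈M-trans M′≈ (⊗-assoc _ M (GL.inv Q))))
                     (⊗-cancelˡ (M ⊗ GL.inv Q) (GL.inv-mat P))) ,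
    ≈M-sym (≈M-trans (⊗-cong (⊗-cong (≈M-refl {A = GL.inv Q}) (≈M-trans N′≈ (⊗-assoc (GL.mat Q) N (GL.inv T)))) ≈M-refl)
           (≈M-trans (⊗-cong (⊗-cancelˡ (N ⊗ GL.inv T) (GL.inv-mat Q)) ≈M-refl)
                     (⊗-cancelʳ N (GL.inv-mat T))))

  transforms-trans : ∀ {r} {X Y Z : Mat r × Mat r} → Transforms X Y → Transforms Y Z → Transforms X Z
  transforms-trans {X = M , N} {M′ , N′} {M″ , N″} (P , Q , T , e , f) (P′ , Q′ , T′ , e′ , f′) =
    P′ ⊗ P , Q′ ⊗ Q , T ⊗ T′ ,
    ≈M-trans (≈M-sym (⊗-assoc M″ Q′ Q)) (≈M-trans (⊗-cong e′ ≈M-refl) (≈M-trans (⊗-assoc P′ M′ Q)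
      (≈M-trans (⊗-cong ≈M-refl e) (≈M-sym (⊗-assoc P′ P M))))) ,
    ≈M-trans f′ (≈M-trans (⊗-cong (⊗-cong (≈M-refl {A = Q′}) f) ≈M-refl)
      (≈M-trans (⊗-cong (≈M-sym (⊗-assoc Q′ (Q ⊗ N) T)) ≈M-refl)
      (≈M-trans (⊗-assoc (Q′ ⊗ (Q ⊗ N)) T T′) (⊗-cong (≈M-sym (⊗-assoc Q′ Q N)) ≈M-refl))))

  -- Entrywise the hypothesis equates `(t ^ μ i) * Q i j` with `P i j * (t ^ μ j)`, and `t ^ μ i`
  -- cancels when `μ i ≤ μ j`. In use, `Q` is the matrix `V` linking two generic matrices of one
  -- orbit.
  admissible-∣∞ : ∀ {r} (μ : Partition r) {P Q : Mat r} → Dμ μ ⊗ Q ≈M P ⊗ Dμ μ →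
    ∀ i j → fin (proj₁ μ j ∸ proj₁ μ i) ∣∞ Q i j
  admissible-∣∞ (μ , _) {P} {Q} DQ≈PD i j with ℕₚ.≤-total (μ j) (μ i)
  ... | inj₁ μj≤μi = ∣∞-antitone (≤∞-reflexive (cong fin (ℕₚ.m≤n⇒m∸n≡0 μj≤μi))) (1∣∞ (Q i j))
  ... | inj₂ μi≤μj = fin∣ (P i j) (t^-cancelˡ (μ i) (begin
    (t ^ μ i) * Q i j                          ≈⟨ diag-⊗ (λ i → t ^ μ i) Q i j ⟨
    (diag (λ i → t ^ μ i) ⊗ Q) i j             ≈⟨ DQ≈PD i j ⟩
    (P ⊗ diag (λ i → t ^ μ i)) i j             ≈⟨ ⊗-diag P (λ i → t ^ μ i) i j ⟩
    P i j * (t ^ μ j)                          ≈⟨ *-comm (P i j) _ ⟩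
    (t ^ μ j) * P i j                          ≈⟨ *-congʳ (reflexive (cong (t ^_) (≡.sym (ℕₚ.m+[n∸m]≡n μi≤μj)))) ⟩
    (t ^ (μ i ℕ.+ (μ j ∸ μ i))) * P i j        ≈⟨ *-congʳ (^-+ t (μ i) (μ j ∸ μ i)) ⟩
    ((t ^ μ i) * (t ^ (μ j ∸ μ i))) * P i j    ≈⟨ *-assoc _ _ (P i j) ⟩
    (t ^ μ i) * ((t ^ (μ j ∸ μ i)) * P i j)    ∎))

  -- Weights of row choices

  sumℕ-mono : ∀ n {f g : Fin n → ℕ} → (∀ i → f i ≤ g i) → sumℕ n f ≤ sumℕ n g
  sumℕ-mono zero    f≤g = z≤n
  sumℕ-mono (suc n) f≤g = ℕₚ.+-mono-≤ (f≤g zero) (sumℕ-mono n (f≤g ∘ suc))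

  sumℕ-∸ : ∀ n (f g : Fin n → ℕ) → sumℕ n f ∸ sumℕ n g ≤ sumℕ n (λ i → f i ∸ g i)
  sumℕ-∸ n f g = ℕₚ.m≤n+o⇒m∸n≤o (sumℕ n f) (sumℕ n g) (bound n f g)
    where
    bound : ∀ n (f g : Fin n → ℕ) → sumℕ n f ≤ sumℕ n g ℕ.+ sumℕ n (λ i → f i ∸ g i)
    bound zero    f g = z≤n
    bound (suc n) f g = ℕₚ.≤-trans
      (ℕₚ.+-mono-≤ (ℕₚ.m≤n+m∸n (f zero) (g zero)) (bound n (f ∘ suc) (g ∘ suc)))
      (ℕₚ.≤-reflexive (interchange (g zero) (f zero ∸ g zero) _ _))
      where open Algebra.Properties.CommutativeSemigroup ℕₚ.+-commutativeSemigroup using (interchange)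

  -- The power of `t` that `admissible-∣∞` guarantees in the product of the entries in rows `I a`
  -- and columns `f a`. The map `f` is arbitrary, as the terms of `det-expand-rows` require.
  weight : ∀ {k r} → Partition r → (I f : Fin k → Fin r) → ℕ
  weight {k} (μ , _) I f = sumℕ k (λ a → μ (f a) ∸ μ (I a))

  -- Only the two swapped positions matter. Since `μ` is decreasing, the descent of `f` and the
  -- increase of `I` supply the two hypotheses of `∸-exchange`.
  weight-swap : ∀ {k r} (μ : Partition r) (I : Fin k → Fin r) → Increasing I →
    ∀ f p → f (upper p) Fin.< f (lower p) → weight μ I (f ∘ swap p) ≤ weight μ I f
  weight-swap {suc (suc k)} (μ , anti) I inc f here d =
    ℕₚ.≤-trans (ℕₚ.≤-reflexive (≡.sym (ℕₚ.+-assoc (B ∸ J) (A ∸ K) w)))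
      (ℕₚ.≤-trans (ℕₚ.+-monoˡ-≤ w (∸-exchange
          (anti (f (suc zero)) (f zero) (ℕₚ.<⇒≤ d))
          (anti (I zero) (I (suc zero)) (ℕₚ.<⇒≤ (inc zero (suc zero) z<s)))))
        (ℕₚ.≤-reflexive (ℕₚ.+-assoc (A ∸ J) (B ∸ K) w)))
    where
    A B J K w : ℕ
    A = μ (f zero)
    B = μ (f (suc zero))
    J = μ (I zero)
    K = μ (I (suc zero))
    w = sumℕ k (λ a → μ (f (suc (suc a))) ∸ μ (I (suc (suc a))))
  weight-swap {suc k} μ I inc f (there p) d = ℕₚ.+-monoʳ-≤ (proj₁ μ (f zero) ∸ proj₁ μ (I zero))
    (weight-swap μ (I ∘ suc) (λ a b a<b → inc (suc a) (suc b) (s<s a<b)) (f ∘ suc) p d)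

-- Minors of generic matrices

module Genericity {c ℓ} (D : DVR c ℓ) (char0 : ResidueChar0 D) where
  open DVR D hiding (zero)
  open Mats D
  open Determinants D
  open Orders D

  ⊑-trans : ∀ {r k} {H I J : IndexSet r k} → H ⊑ I → I ⊑ J → H ⊑ J
  ⊑-trans H⊑I I⊑J s = ℕₚ.≤-trans (H⊑I s) (I⊑J s)

  infixl 6 _⊓_
  _⊓_ : ∀ {r k} → IndexSet r k → IndexSet r k → IndexSet r k
  I ⊓ S = record
    { ix   = λ a → minFin (ix I a) (ix S a)
    ; incr = λ a b a<b → minFin-glb-<
        (ℕₚ.≤-<-trans (minFin-≤ˡ (ix I a) (ix S a)) (incr I a b a<b))
        (ℕₚ.≤-<-trans (minFin-≤ʳ (ix I a) (ix S a)) (incr S a b a<b))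
    }

  -- Where the minimum picks `I` the difference is zero; where it picks `S` it is the matching term
  -- of the weight.
  weight-⊓ : ∀ {r k} (μ : Partition r) (I S : IndexSet r k) →
    (∣ μ ∣ (I ⊓ S)) ∸ (∣ μ ∣ I) ≤ weight μ (ix I) (ix S)
  weight-⊓ {k = k} (μ , _) I S = ℕₚ.≤-trans
    (sumℕ-∸ k (λ a → μ (ix (I ⊓ S) a)) (λ a → μ (ix I a)))
    (sumℕ-mono k λ a → bound (ix I a) (ix S a))
    where
    bound : ∀ i s → μ (minFin i s) ∸ μ i ≤ μ s ∸ μ i
    bound i s with minFin i s | minFin-sel i s
    ... | _ | inj₁ ≡.refl = ℕₚ.≤-trans (ℕₚ.≤-reflexive (ℕₚ.n∸n≡0 (μ i))) z≤n
    ... | _ | inj₂ ≡.refl = ℕₚ.≤-refl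

  -- For such a `J` the range `H ⊑ J` in the third minimum formula contains every column set.
  Last : ∀ {r k} → IndexSet r k → Set
  Last J = ∀ H → H ⊑ J

  module _ {r} {μ : Partition r} {N* : Mat r} (G : IsGeneric μ N*) where
    open IsGeneric G
    private
      N° NTL : Mat r
      N° = Q ⊗ N ⊗ Tinv
      NTL = Q ⊗ N ⊗ TL

    -- The minimum for `S` is attained at some `S′` above `S`, hence above `I`, so `S′` also
    -- competes in the minimum for `I`.
    minor-mono-rows : ∀ {k} {I S J : IndexSet r k} → I ⊑ S → ‖minor‖ N° I J ≤∞ ‖minor‖ N° S J
    minor-mono-rows {k} {I} {S} {J} I⊑S with proj₁ (minors k S J) | proj₁ (minors k I J)
    ... | (S′ , S⊑S′ , eq) , _ | _ , lower-bound =
      ≤∞-trans (lower-bound S′ (⊑-trans {H = I} {S} {S′} I⊑S S⊑S′)) (≤∞-reflexive eq)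

    -- The minimiser `H` for `X` lies below `I` as well, and `∸-triangle` splits its penalty
    -- relative to `I` at `X`.
    minor-anti-rows : ∀ {k} {X I J : IndexSet r k} → X ⊑ I →
      ‖minor‖ N° I J ≤∞ ‖minor‖ N° X J +∞ fin ((∣ μ ∣ X) ∸ (∣ μ ∣ I))
    minor-anti-rows {k} {X} {I} {J} X⊑I with proj₁ (proj₂ (minors k X J)) | proj₁ (proj₂ (minors k I J))
    ... | (H , H⊑X , eq) , _ | _ , lower-bound =
      ≤∞-trans (lower-bound H (⊑-trans {H = H} {X} {I} H⊑X X⊑I))
      (≤∞-trans (+∞-mono (≤∞-refl {h}) (fin≤fin (∸-triangle (∣ μ ∣ H) (∣ μ ∣ X) (∣ μ ∣ I))))
      (≤∞-trans (≤∞-reflexive (≡.sym (+∞-assoc h ((∣ μ ∣ H) ∸ (∣ μ ∣ X)) ((∣ μ ∣ X) ∸ (∣ μ ∣ I)))))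
                (+∞-mono (≤∞-reflexive eq) ≤∞-refl)))
      where h = ‖minor‖ (QhU ⊗ N ⊗ Tinv) H J

    -- The route is through `I ⊓ S`: going down from `I` costs at most the weight, going up to `S`
    -- costs nothing, and the third minimum formula then passes from columns `J` of `N°` to columns
    -- `H` of `NTL`.
    minor-≤-minors : ∀ {k} (I S J H : IndexSet r k) → H ⊑ J →
      ‖minor‖ N° I J ≤∞ fin (weight μ (ix I) (ix S)) +∞ ‖minor‖ NTL S H
    minor-≤-minors {k} I S J H H⊑J =
      ≤∞-trans (minor-anti-rows {X = X} {I} {J} (λ a → minFin-≤ˡ (ix I a) (ix S a)))
      (≤∞-trans (+∞-mono
        (≤∞-trans (minor-mono-rows {I = X} {S} {J} (λ a → minFin-≤ʳ (ix I a) (ix S a)))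
                  (proj₂ (proj₂ (proj₂ (minors k S J))) H H⊑J))
        (fin≤fin (weight-⊓ μ I S)))
      (≤∞-reflexive (+∞-comm (‖minor‖ NTL S H) (fin (weight μ (ix I) (ix S))))))
      where X = I ⊓ S

    -- Extends `minor-≤-minors` to unsorted and repeating choices, sorting rows in the outer
    -- induction and columns in the inner one. Repetitions kill the determinant, and swaps preserve
    -- its order.
    minor-≤-dets : ∀ {k} (I J : IndexSet r k) → Last J → (f g : Fin k → Fin r) →
      ‖minor‖ N° I J ≤∞ fin (weight μ (ix I) f) +∞ ord (det k (sub NTL f g))
    minor-≤-dets {k} I J last = bubbleSort-induction
      (λ f → ∀ g → ‖minor‖ N° I J ≤∞ fin (weight μ (ix I) f) +∞ ord (det k (sub NTL f g)))
      (λ f f↑ → bubbleSort-induction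
        (λ g → ‖minor‖ N° I J ≤∞ fin (weight μ (ix I) f) +∞ ord (det k (sub NTL f g)))
        (λ g g↑ → minor-≤-minors I (indexSet f f↑) J (indexSet g g↑) (last (indexSet g g↑)))
        -- Equal columns are equal rows of the transpose.
        (λ g p eq → vanishing (weight μ (ix I) f) (trans (sym (det-transpose k (sub NTL f g)))
          (det-equal-rows char0 (λ h a → NTL (f a) h) g p eq)))
        (λ g p _ bound → ≤∞-trans bound (+∞-mono (≤∞-refl {fin (weight μ (ix I) f)}) (≤∞-reflexive (ord-neg-cong
          (trans (sym (det-transpose k (sub NTL f (g ∘ swap p))))
          (trans (det-swap-rows p ((sub NTL f g) ᵀ)) (-‿cong (det-transpose k (sub NTL f g))))))))))
      (λ f p eq g → vanishing (weight μ (ix I) f) (det-equal-rows char0 (λ s b → NTL s (g b)) f p eq))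
      -- A row swap also changes the weight, but never upwards, so the bound for the swapped map
      -- passes back to `f`.
      (λ f p d bound g → ≤∞-trans (bound g) (+∞-mono
        (fin≤fin (weight-swap μ (ix I) (incr I) f p d))
        (≤∞-reflexive (ord-neg-cong (det-swap-rows p (sub NTL f g))))))
      where
      indexSet : ∀ f → Increasing f → IndexSet r k
      indexSet f f↑ = record { ix = f ; incr = f↑ }
      vanishing : ∀ {x} w {d} → d ≈ 0# → x ≤∞ fin w +∞ ord d
      vanishing {x} w d≈0 = ≤∞-trans (≤∞-top x) (+∞-mono (≤∞-refl {fin w}) (≤ord-0 {∞} d≈0))

    -- With `N*′` factored as `V ⊗ (NTL ⊗ C)`, the minor is expanded in rows and then in columns.
    -- The row coefficients from `V` pay for the weight, while the column coefficients from `C` are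
    -- arbitrary ring elements.
    minor-≤-transformed : ∀ {N*′ : Mat r} → Transforms (Dμ μ , N*) (Dμ μ , N*′) →
      ∀ {k} (I J : IndexSet r k) → Last J → ‖minor‖ N* I J ≤∞ ‖minor‖ N*′ I J
    minor-≤-transformed {N*′} (P , V , T , DV≈PD , N*′≈) {k} I J last =
      ≤∞-trans (≤∞-reflexive (ord-cong (det-cong k λ a b → N*-eq (ix I a) (ix J b))))
      (∣∞⇒≤ord (∣∞-resp-≈
        (trans (sym (det-expand-rows k r (V ∘ ix I) (λ s b → W s (ix J b))))
               (det-cong k λ a b → sym (factored (ix I a) (ix J b))))
        (∣∞-sumMaps k rowTerm)))
      where
      C W : Mat r
      C = TU ⊗ T
      W = NTL ⊗ C
      factored : N*′ ≈M V ⊗ W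
      factored = ≈M-trans N*′≈ (≈M-trans (⊗-assoc V N* T) (⊗-cong ≈M-refl
        (≈M-trans (⊗-cong (≈M-trans N*-eq (≈M-sym (⊗-assoc (Q ⊗ N) TL TU))) ≈M-refl) (⊗-assoc NTL TU T))))
      π : (Fin k → Fin r) → Carrier
      π f = prodF k (λ a → V (ix I a) (f a))
      κ : (Fin k → Fin r) → Carrier
      κ g = prodF k (λ b → C (g b) (ix J b))
      rowTerm : ∀ f → ‖minor‖ N° I J ∣∞ π f * det k (λ a b → W (f a) (ix J b))
      rowTerm f = ∣∞-resp-≈
        (sym (trans (*-congˡ {x = π f} columns) (sumMaps-*ˡ k (π f) (λ g → κ g * det k ((sub NTL f g) ᵀ)))))
        -- Admissibility puts `t` to the weight into `π f`, the determinant contributes its own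
        -- order, and `minor-≤-dets` compares the total with the minor of `N°`.
        (∣∞-sumMaps k λ g → ∣∞-antitone (minor-≤-dets I J last f g)
          (∣∞-* (∣∞-prodF k (λ a → proj₁ μ (f a) ∸ proj₁ μ (ix I a))
                   (λ a → admissible-∣∞ μ DV≈PD (ix I a) (f a)))
                (∣∞-*ˡ (κ g) (∣∞-resp-≈ (sym (det-transpose k (sub NTL f g))) (ord∣∞ (det k (sub NTL f g)))))))
        where
        columns : det k (λ a b → W (f a) (ix J b)) ≈ sumMaps k r (λ g → κ g * det k ((sub NTL f g) ᵀ))
        -- After transposition the sum over `h` becomes a combination of rows, to which
        -- `det-expand-rows` applies.
        columns = trans (sym (det-transpose k (λ a b → W (f a) (ix J b))))
          (trans (det-cong k λ b a → sumF-cong r λ h → *-comm (NTL (f a) h) (C h (ix J b)))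
                 (det-expand-rows k r (λ b h → C h (ix J b)) (λ h a → NTL (f a) h)))

  -- The minors that determine the filling

  keptIndexSet : ∀ r a b → IndexSet r _
  keptIndexSet r a b = record
    { ix   = lookup (keptRows r a b)
    ; incr = lookup-increasing (AllPairsₚ.filter⁺ _ (AllPairsₚ.tabulate⁺-< (λ i<j → i<j)))
    }

  lastIndexSet : ∀ {r m} → m ≤ r → IndexSet r m
  lastIndexSet m≤r = record
    { ix   = lastCols m≤r
    ; incr = λ a b a<b → opposite-anti-< (≡.subst₂ _<_
        (≡.sym (Finₚ.toℕ-inject≤ (opposite b) m≤r)) (≡.sym (Finₚ.toℕ-inject≤ (opposite a) m≤r))
        (opposite-anti-< a<b))
    }

  -- Reversing both sides of H turns the claim into s ≤ f s for increasing f.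
  lastIndexSet-last : ∀ {r m} (m≤r : m ≤ r) → Last (lastIndexSet m≤r)
  lastIndexSet-last m≤r H s = subst (Fin._≤ lastCols m≤r s) (Finₚ.opposite-involutive (ix H s))
    (opposite-anti-≤ (ℕₚ.≤-trans (ℕₚ.≤-reflexive (Finₚ.toℕ-inject≤ (opposite s) m≤r))
      (ℕₚ.≤-trans (increasing⇒expanding reversed reversed↑ (opposite s))
        (ℕₚ.≤-reflexive (cong (toℕ ∘ opposite ∘ ix H) (Finₚ.opposite-involutive s))))))
    where
    reversed : Fin _ → Fin _
    reversed a = opposite (ix H (opposite a))
    reversed↑ : Increasing reversed
    reversed↑ a b a<b = opposite-anti-< (incr H (opposite b) (opposite a) (opposite-anti-< a<b))

  Ω-≤-transformed : ∀ {r} {μ : Partition r} {N* N*′ : Mat r} → IsGeneric μ N* →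
    Transforms (Dμ μ , N*) (Dμ μ , N*′) → ∀ a b → Ω N* a b ≤∞ Ω N*′ a b
  Ω-≤-transformed {r} G τ a b =
    minor-≤-transformed G τ (keptIndexSet r a b) (lastIndexSet m≤r) (lastIndexSet-last m≤r)
    where m≤r = keptRows-≤ r a b

  partialSum-cong : ∀ {r} {N N′ : Mat r} → (∀ a b → Ω N a b ≡ Ω N′ a b) →
    ∀ i j → partialSum N i j ≡ partialSum N′ i j
  partialSum-cong eq zero    j = ≡.refl
  partialSum-cong eq (suc i) j = cong₂ diff∞ (eq (j ∸ suc i) (j ∸ 1)) (eq (j ∸ suc i ℕ.+ 1) j)

  filling-cong : ∀ {r} {N N′ : Mat r} → (∀ a b → Ω N a b ≡ Ω N′ a b) →
    ∀ i j → filling N i j ≡ filling N′ i j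
  filling-cong eq zero    j = ≡.refl
  filling-cong {N = N} {N′} eq (suc i) j
    -- The partial sums of both matrices are abstracted together with the equations identifying
    -- them, so that both sides of the goal reduce in the same branch.
    with partialSum N (suc i) j | partialSum N i j | partialSum N′ (suc i) j | partialSum N′ i j
       | partialSum-cong {N = N} {N′} eq (suc i) j | partialSum-cong {N = N} {N′} eq i j
  ... | just _  | just _  | _ | _ | ≡.refl | ≡.refl = ≡.refl
  ... | just _  | nothing | _ | _ | ≡.refl | ≡.refl = ≡.refl
  ... | nothing | _       | _ | _ | ≡.refl | ≡.refl = ≡.refl

mainTheorem2 : ∀ {c ℓ} (D : DVR c ℓ) → ResidueChar0 D →
    let open Mats D in
    (r : ℕ) (M N M' N' : Mat r) →
    FullRank M → FullRank N → FullRank M' → FullRank N' →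
    PairEquiv (M , N) (M' , N') →
    (μ : Partition r) → IsInv M μ →
    (N* N'* : Mat r) → IsGeneric μ N* → IsGeneric μ N'* →
    PairEquiv (M , N) (Dμ μ , N*) →
    PairEquiv (M' , N') (Dμ μ , N'*) →
    ∀ (i j : ℕ) → 1 ≤ i → i ≤ j → j ≤ r →
    filling N* i j ≡ filling N'* i j
mainTheorem2 D char0 r M N M' N' _ _ _ _ e μ _ N* N'* G G' e* e'* i j _ _ _ =
  filling-cong (λ a b → ≤∞-antisym (Ω-≤-transformed G τ a b) (Ω-≤-transformed G' τ⁻¹ a b)) i j
  where
  open Mats D
  open Orders D
  open Genericity D char0
  τ : Transforms (Dμ μ , N*) (Dμ μ , N'*)
  -- The path runs from `N*` back to `(M , N)`, across to `(M' , N')` and on to `N'*`. Since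
  -- `Transforms` records no inverses, the reverse path is composed separately.
  τ = transforms-trans (transforms⁻¹ e*) (transforms-trans (transforms e) (transforms e'*))
  τ⁻¹ : Transforms (Dμ μ , N'*) (Dμ μ , N*)
  τ⁻¹ = transforms-trans (transforms⁻¹ e'*) (transforms-trans (transforms⁻¹ e) (transforms e*))
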